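{- For every fixed positive integer $n$, the sequence $\mathrm{BoNa}(n,1),\mathrm{BoNa}(n,2),\ldots,\mathrm{BoNa}(n,n)$ is log-concave.
   Context: A binary plane tree is a rooted plane tree on unlabeled vertices in which every non-leaf vertex has one or two children, and every child is a left child or a right child, even if it is the only child of its parent. A 0-1-tree is a binary plane tree in which every vertex that has two children is labeled 0 or 1 (no other vertex is labeled). A right edge is an edge connecting a vertex to its right child. For $n\ge 1$, the Boolean-Narayana number $\mathrm{BoNa}(n,k)$ is the number of 0-1-trees on $n$ vertices that have exactly $k-1$ right edges. A sequence $a_1,a_2,\ldots$ (finite or infinite) of nonnegative real numbers is log-concave if $a_{i-1}a_{i+1}\leq a_i^2$ for every index $i$ for which $a_{i-1}$, $a_i$ and $a_{i+1}$ are all terms of the sequence. -}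

module Defs where

open import Data.Fin using (Fin; toℕ)
open import Data.List using (List; []; _∷_; _++_; map; filter; length; allFin; cartesianProduct; cartesianProductWith)
open import Data.List.Membership.Propositional using (_∈_)
open import Data.List.Membership.Propositional.Properties
  using (∈-map⁺; ∈-map⁻; ∈-++⁺ˡ; ∈-++⁺ʳ; ∈-++⁻; ∈-allFin; ∈-filter⁺; ∈-filter⁻
        ; ∈-cartesianProduct⁺; ∈-cartesianProductWith⁺; ∈-cartesianProductWith⁻)
open import Data.List.Relation.Unary.All using (tabulate)
open import Data.List.Relation.Unary.Any using (here; there)
open import Data.List.Relation.Unary.AllPairs using ([]; _∷_)
open import Data.List.Relation.Unary.Unique.Propositional using (Unique)
open import Data.List.Relation.Unary.Unique.Propositional.Properties
  using (map⁺; ++⁺; allFin⁺; cartesianProduct⁺; cartesianProductWith⁺; filter⁺)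
open import Data.Nat using (ℕ; zero; suc; _+_; _*_; _≤_; s≤s; _≟_)
open import Data.Nat.Properties using (≤-reflexive; m+n≤o⇒m≤o; m+n≤o⇒n≤o)
open import Data.Product using (_×_; _,_; proj₂)
open import Data.Sum using (inj₁; inj₂)
open import Function.Bundles using (_⇔_; mk⇔)
open import Relation.Binary.PropositionalEquality using (_≡_; _≢_; refl)
open import Relation.Nullary using (¬_)
open import Relation.Nullary.Decidable using (_×-dec_)
open import Relation.Unary using (Decidable)

-- Trees are nonempty: each constructor is a root vertex, together with its
-- subtrees.  In `both`, the Fin 2 argument is the 0/1 label of the root.
data 01-Tree : Set where
  leaf      : 01-Tree
  onlyLeft  : 01-Tree → 01-Tree
  onlyRight : 01-Tree → 01-Tree
  both      : Fin 2 → (left right : 01-Tree) → 01-Tree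

vertices : 01-Tree → ℕ
vertices leaf          = 1
vertices (onlyLeft t)  = suc (vertices t)
vertices (onlyRight t) = suc (vertices t)
vertices (both _ l r)  = suc (vertices l + vertices r)

rightEdges : 01-Tree → ℕ
rightEdges leaf          = 0
rightEdges (onlyLeft t)  = rightEdges t
rightEdges (onlyRight t) = suc (rightEdges t)
rightEdges (both _ l r)  = suc (rightEdges l + rightEdges r)

-- The second equation says rightEdges t = k - 1, with no truncation at k = 0.
Counted : ℕ → ℕ → 01-Tree → Set
Counted n k t = vertices t ≡ n × suc (rightEdges t) ≡ k

counted? : ∀ n k → Decidable (Counted n k)
counted? n k t = (vertices t ≟ n) ×-dec (suc (rightEdges t) ≟ k)

-- All trees with at most h levels of vertices, each listed once.
treesUpToHeight : ℕ → List 01-Tree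
treesUpToHeight zero    = []
treesUpToHeight (suc h) =
  leaf ∷ map onlyLeft ts ++ map onlyRight ts
       ++ cartesianProductWith (λ b (l , r) → both b l r) (allFin 2) (cartesianProduct ts ts)
  where ts = treesUpToHeight h

-- A tree on n vertices has at most n levels, so none is missed: see
-- ∈-countedTrees and countedTrees-unique below.
countedTrees : ℕ → ℕ → List 01-Tree
countedTrees n k = filter (counted? n k) (treesUpToHeight n)

BoNa : ℕ → ℕ → ℕ
BoNa n k = length (countedTrees n k)

-- Log-concavity of a finite sequence of natural numbers; the condition is
-- imposed on every three consecutive indices h, i, j of the sequence.
LogConcave : ∀ {n} → (Fin n → ℕ) → Set
LogConcave {n} a =
  ∀ (h i j : Fin n) → toℕ i ≡ suc (toℕ h) → toℕ j ≡ suc (toℕ i) →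
  a h * a j ≤ a i * a i

∈-treesUpToHeight : ∀ h t → vertices t ≤ h → t ∈ treesUpToHeight h
∈-treesUpToHeight (suc h) leaf _ = here refl
∈-treesUpToHeight (suc h) (onlyLeft t) (s≤s p) =
  there (∈-++⁺ˡ (∈-map⁺ onlyLeft (∈-treesUpToHeight h t p)))
∈-treesUpToHeight (suc h) (onlyRight t) (s≤s p) =
  there (∈-++⁺ʳ (map onlyLeft (treesUpToHeight h))
    (∈-++⁺ˡ (∈-map⁺ onlyRight (∈-treesUpToHeight h t p))))
∈-treesUpToHeight (suc h) (both b l r) (s≤s p) =
  there (∈-++⁺ʳ (map onlyLeft ts) (∈-++⁺ʳ (map onlyRight ts)
    (∈-cartesianProductWith⁺ (λ b (l , r) → both b l r) (∈-allFin b)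
      (∈-cartesianProduct⁺
        (∈-treesUpToHeight h l (m+n≤o⇒m≤o (vertices l) p))
        (∈-treesUpToHeight h r (m+n≤o⇒n≤o (vertices l) p))))))
  where ts = treesUpToHeight h

treesUpToHeight-unique : ∀ h → Unique (treesUpToHeight h)
treesUpToHeight-unique zero    = []
treesUpToHeight-unique (suc h) =
  tabulate leaf-fresh ∷
  ++⁺ (map⁺ (λ { refl → refl }) u)
      (++⁺ (map⁺ (λ { refl → refl }) u)
           (cartesianProductWith⁺ mk (λ { refl → refl , refl }) (allFin⁺ 2) (cartesianProduct⁺ u u))
           right-both)
      left-rest
  where
  ts = treesUpToHeight h
  u  = treesUpToHeight-unique h
  mk : Fin 2 → 01-Tree × 01-Tree → 01-Tree
  mk b (l , r) = both b l r
  bs = cartesianProductWith mk (allFin 2) (cartesianProduct ts ts)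

  leaf-fresh : ∀ {t} → t ∈ map onlyLeft ts ++ map onlyRight ts ++ bs → leaf ≢ t
  leaf-fresh p refl with ∈-++⁻ (map onlyLeft ts) p
  ... | inj₁ q with _ , _ , () ← ∈-map⁻ onlyLeft q
  ... | inj₂ q with ∈-++⁻ (map onlyRight ts) q
  ...   | inj₁ r with _ , _ , () ← ∈-map⁻ onlyRight r
  ...   | inj₂ r with _ , _ , _ , _ , () ← ∈-cartesianProductWith⁻ mk (allFin 2) (cartesianProduct ts ts) r

  right-both : ∀ {t} → ¬ (t ∈ map onlyRight ts × t ∈ bs)
  right-both (p , q) with _ , _ , refl ← ∈-map⁻ onlyRight p
    with _ , _ , _ , _ , () ← ∈-cartesianProductWith⁻ mk (allFin 2) (cartesianProduct ts ts) q

  left-rest : ∀ {t} → ¬ (t ∈ map onlyLeft ts × t ∈ map onlyRight ts ++ bs)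
  left-rest (p , q) with _ , _ , refl ← ∈-map⁻ onlyLeft p | ∈-++⁻ (map onlyRight ts) q
  ... | inj₁ r with _ , _ , () ← ∈-map⁻ onlyRight r
  ... | inj₂ r with _ , _ , _ , _ , () ← ∈-cartesianProductWith⁻ mk (allFin 2) (cartesianProduct ts ts) r

∈-countedTrees : ∀ n k t → t ∈ countedTrees n k ⇔ Counted n k t
∈-countedTrees n k t = mk⇔
  (λ p → proj₂ (∈-filter⁻ (counted? n k) {xs = treesUpToHeight n} p))
  (λ c@(v , _) → ∈-filter⁺ (counted? n k) (∈-treesUpToHeight n t (≤-reflexive v)) c)

countedTrees-unique : ∀ n k → Unique (countedTrees n k)
countedTrees-unique n k = filter⁺ (counted? n k) (treesUpToHeight-unique n)

{-# OPTIONS --safe #-}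

-- Count plane forests of p trees with e left and a right edges by deleting the
-- root of the first tree.  With n = p + e + a, this recurrence is solved by
--   n · count p e a = p · [u^(e+a) y^a] (1 + (1+y)u + 2yu²)^n,
-- an instance of Lagrange inversion that is proved directly by induction on n.
-- As 1 + (1+y)u + 2yu² = (1+u) + yu(1+2u), the case p = 1 reads
--   n · BoNa n (a+1) = C(n,a) · R(a,e),   R(a,e) = [u^e] (1+2u)^a (1+u)^(e+1),
-- where e + a + 1 = n.  Binomial rows are log-concave, so it remains to compare
-- R along an antidiagonal.  R satisfies the Delannoy recurrence
--   R(a+1,c+1) = R(a+1,c) + R(a,c+1) + R(a,c),
-- that is, row a+1 is row a multiplied by (1+v)/(1-v) = 1 + 2v/(1-v).  This keeps
-- rows log-concave, whence the 2×2 minors of adjacent rows are nonnegative, whence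
-- columns are log-concave.  Multiplying two such minors by a row and a column
-- inequality gives R(a,c+2) R(a+2,c) ≤ R(a+1,c+1)².
module Submission where

open import Data.Fin using (Fin; zero; suc; toℕ)
open import Data.Fin.Properties using (toℕ<n)
open import Data.List using (List; []; _∷_; _++_; map; length)
open import Data.List.Membership.Propositional using (_∈_)
open import Data.List.Membership.Propositional.Properties using (∈-map⁺; ∈-map⁻; ∈-++⁺ˡ; ∈-++⁺ʳ)
open import Data.List.Membership.Propositional.Properties.WithK using (unique∧set⇒bag)
open import Data.List.Properties using (length-++; length-map)
open import Data.List.Relation.Binary.BagAndSetEquality using (∼bag⇒↭)
open import Data.List.Relation.Binary.Permutation.Propositional.Properties using (↭-length)
import Data.List.Relation.Unary.All as All
import Data.List.Relation.Unary.All.Properties as All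
open import Data.List.Relation.Unary.All using (All; []; _∷_)
open import Data.List.Relation.Unary.AllPairs using ([]; _∷_)
open import Data.List.Relation.Unary.Any using (here)
open import Data.List.Relation.Unary.Unique.Propositional using (Unique)
import Data.List.Relation.Unary.Unique.Propositional.Properties as Unique
open import Data.Nat
open import Data.Nat.Properties
open import Data.Nat.Tactic.RingSolver using (solve-∀)
open import Data.Product using (_×_; _,_)
open import Data.Sum using (inj₁; inj₂; [_,_]′)
open import Data.Vec as Vec using (Vec; []; _∷_)
open import Function.Bundles using (mk⇔; Equivalence)
open import Relation.Binary.PropositionalEquality
open import Relation.Nullary using (contradiction)
open import Relation.Nullary.Decidable using (True; toWitness)
open import Defs

-- Plane forests by numbers of trees, left edges and right edges.

leftEdges : 01-Tree → ℕ
leftEdges leaf          = 0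
leftEdges (onlyLeft t)  = suc (leftEdges t)
leftEdges (onlyRight t) = leftEdges t
leftEdges (both _ l r)  = suc (leftEdges l + leftEdges r)

vertices-edges : ∀ t → vertices t ≡ suc (leftEdges t + rightEdges t)
vertices-edges leaf          = refl
vertices-edges (onlyLeft t)  = cong suc (vertices-edges t)
vertices-edges (onlyRight t) =
  cong suc (trans (vertices-edges t) (sym (+-suc (leftEdges t) (rightEdges t))))
vertices-edges (both _ l r)  = cong suc (trans
  (cong₂ _+_ (vertices-edges l) (vertices-edges r))
  (rearrange (leftEdges l) (rightEdges l) (leftEdges r) (rightEdges r)))
  where
  rearrange : ∀ u v x y → suc (u + v) + suc (x + y) ≡ suc (u + x) + suc (v + y)
  rearrange = solve-∀

Forest : ℕ → Set
Forest = Vec 01-Tree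

graftLeft graftRight : ∀ {p} → Forest (suc p) → Forest (suc p)
graftLeft  (t ∷ ts) = onlyLeft t ∷ ts
graftRight (t ∷ ts) = onlyRight t ∷ ts

graftBoth : ∀ {p} → Fin 2 → Forest (suc (suc p)) → Forest (suc p)
graftBoth b (l ∷ r ∷ ts) = both b l r ∷ ts

-- p trees, e left edges, a right edges.
forests : (p e a : ℕ) → List (Forest p)
bothRoot : Fin 2 → (p e a : ℕ) → List (Forest (suc p))
leftRoot rightRoot : (p e a : ℕ) → List (Forest (suc p))

forests zero    zero    zero    = [] ∷ []
forests zero    zero    (suc _) = []
forests zero    (suc _) _       = []
forests (suc p) e       a       =
  map (leaf ∷_) (forests p e a) ++ leftRoot p e a ++ rightRoot p e a
    ++ bothRoot zero p e a ++ bothRoot (suc zero) p e a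

leftRoot p zero    a = []
leftRoot p (suc e) a = map graftLeft (forests (suc p) e a)

rightRoot p e zero    = []
rightRoot p e (suc a) = map graftRight (forests (suc p) e a)

bothRoot b p zero    a       = []
bothRoot b p (suc e) zero    = []
bothRoot b p (suc e) (suc a) = map (graftBoth b) (forests (suc (suc p)) e a)

-- Induction on `t` works because the rest `ts` of the forest is arbitrary: a root with two children
-- is handled by putting first `r`, then `l`, in front of `ts`, and grafting them.
∷-∈-forests : ∀ t {p e a} {ts : Forest p} → ts ∈ forests p e a →
              t ∷ ts ∈ forests (suc p) (leftEdges t + e) (rightEdges t + a)
∷-∈-forests leaf i = ∈-++⁺ˡ (∈-map⁺ (leaf ∷_) i)
∷-∈-forests (onlyLeft t) {p} {e} {a} i =
  ∈-++⁺ʳ (map (leaf ∷_) (forests p (suc (leftEdges t + e)) (rightEdges t + a)))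
    (∈-++⁺ˡ (∈-map⁺ graftLeft (∷-∈-forests t i)))
∷-∈-forests (onlyRight t) {p} {e} {a} i =
  ∈-++⁺ʳ (map (leaf ∷_) (forests p e′ (suc a′)))
    (∈-++⁺ʳ (leftRoot p e′ (suc a′))
      (∈-++⁺ˡ (∈-map⁺ graftRight (∷-∈-forests t i))))
  where
  e′ = leftEdges t + e
  a′ = rightEdges t + a
∷-∈-forests (both b l r) {p} {e} {a} {ts} i =
  ∈-++⁺ʳ (map (leaf ∷_) (forests p e′ a′))
    (∈-++⁺ʳ (leftRoot p e′ a′) (∈-++⁺ʳ (rightRoot p e′ a′) (label b)))
  where
  e′ = suc (leftEdges l + leftEdges r + e)
  a′ = suc (rightEdges l + rightEdges r + a)

  children : l ∷ r ∷ ts ∈ forests (suc (suc p)) (leftEdges l + leftEdges r + e)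
                                                (rightEdges l + rightEdges r + a)
  children = subst₂ (λ x y → l ∷ r ∷ ts ∈ forests (suc (suc p)) x y)
    (sym (+-assoc (leftEdges l) (leftEdges r) e))
    (sym (+-assoc (rightEdges l) (rightEdges r) a))
    (∷-∈-forests l (∷-∈-forests r i))

  label : ∀ b → both b l r ∷ ts ∈ bothRoot zero p e′ a′ ++ bothRoot (suc zero) p e′ a′
  label zero       = ∈-++⁺ˡ (∈-map⁺ (graftBoth zero) children)
  label (suc zero) = ∈-++⁺ʳ (bothRoot zero p e′ a′) (∈-map⁺ (graftBoth (suc zero)) children)

HasEdges : ∀ {p} → ℕ → ℕ → Forest p → Set
HasEdges e a ts = Vec.sum (Vec.map leftEdges ts) ≡ e × Vec.sum (Vec.map rightEdges ts) ≡ a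

forests-edges : ∀ p e a → All (HasEdges e a) (forests p e a)
leftRoot-edges : ∀ p e a → All (HasEdges e a) (leftRoot p e a)
rightRoot-edges : ∀ p e a → All (HasEdges e a) (rightRoot p e a)
bothRoot-edges : ∀ b p e a → All (HasEdges e a) (bothRoot b p e a)

forests-edges zero    zero    zero    = (refl , refl) ∷ []
forests-edges zero    zero    (suc _) = []
forests-edges zero    (suc _) _       = []
forests-edges (suc p) e       a       =
  All.++⁺ (All.map⁺ (forests-edges p e a)) (All.++⁺ (leftRoot-edges p e a)
    (All.++⁺ (rightRoot-edges p e a)
      (All.++⁺ (bothRoot-edges zero p e a) (bothRoot-edges (suc zero) p e a))))

leftRoot-edges p zero    a = []
leftRoot-edges p (suc e) a =
  All.map⁺ (All.map (λ { {_ ∷ _} (l , r) → cong suc l , r }) (forests-edges (suc p) e a))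

rightRoot-edges p e zero    = []
rightRoot-edges p e (suc a) =
  All.map⁺ (All.map (λ { {_ ∷ _} (l , r) → l , cong suc r }) (forests-edges (suc p) e a))

bothRoot-edges b p zero    a       = []
bothRoot-edges b p (suc e) zero    = []
bothRoot-edges b p (suc e) (suc a) = All.map⁺ (All.map
  (λ { {t ∷ u ∷ _} (l , r) → cong suc (trans (+-assoc (leftEdges t) (leftEdges u) _) l)
                           , cong suc (trans (+-assoc (rightEdges t) (rightEdges u) _) r) })
  (forests-edges (suc (suc p)) e a))

-- The tags increase in the order of the blocks of `forests`, so that disjointness of a block from
-- everything after it becomes one inequality, in the shape that `unique-++` expects.
rootKind : ∀ {p} → Forest (suc p) → ℕ
rootKind (leaf        ∷ _) = 0
rootKind (onlyLeft _  ∷ _) = 1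
rootKind (onlyRight _ ∷ _) = 2
rootKind (both b _ _  ∷ _) = 3 + toℕ b

leftRoot-kind : ∀ p e a → All (λ ts → rootKind ts ≡ 1) (leftRoot p e a)
leftRoot-kind p zero    a = []
leftRoot-kind p (suc e) a = All.map⁺ (All.universal (λ { (_ ∷ _) → refl }) _)

rightRoot-kind : ∀ p e a → All (λ ts → rootKind ts ≡ 2) (rightRoot p e a)
rightRoot-kind p e zero    = []
rightRoot-kind p e (suc a) = All.map⁺ (All.universal (λ { (_ ∷ _) → refl }) _)

bothRoot-kind : ∀ b p e a → All (λ ts → rootKind ts ≡ 3 + toℕ b) (bothRoot b p e a)
bothRoot-kind b p zero    a       = []
bothRoot-kind b p (suc e) zero    = []
bothRoot-kind b p (suc e) (suc a) = All.map⁺ (All.universal (λ { (_ ∷ _ ∷ _) → refl }) _)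

unique-++ : ∀ {A : Set} (f : A → ℕ) {k xs ys} → Unique xs → Unique ys →
            All (λ x → f x ≡ k) xs → All (λ y → k < f y) ys → Unique (xs ++ ys)
unique-++ f u v ps qs = Unique.++⁺ u v
  (λ { (i , j) → <⇒≢ (All.lookup qs j) (sym (All.lookup ps i)) })

forests-unique : ∀ p e a → Unique (forests p e a)
leftRoot-unique : ∀ p e a → Unique (leftRoot p e a)
rightRoot-unique : ∀ p e a → Unique (rightRoot p e a)
bothRoot-unique : ∀ b p e a → Unique (bothRoot b p e a)

forests-unique zero    zero    zero    = [] ∷ []
forests-unique zero    zero    (suc _) = []
forests-unique zero    (suc _) _       = []
forests-unique (suc p) e       a       =
  unique-++ rootKind {0} (Unique.map⁺ (λ { refl → refl }) (forests-unique p e a))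
    (unique-++ rootKind {1} (leftRoot-unique p e a)
      (unique-++ rootKind {2} (rightRoot-unique p e a)
        (unique-++ rootKind {3} (bothRoot-unique zero p e a) (bothRoot-unique (suc zero) p e a)
          (bothRoot-kind zero p e a) (above (bothRoot-kind (suc zero) p e a)))
        (rightRoot-kind p e a) both>2)
      (leftRoot-kind p e a) (All.++⁺ (above (rightRoot-kind p e a)) (All.map <⇒≤ both>2)))
    (All.map⁺ (All.universal (λ _ → refl) _))
    (All.++⁺ (above (leftRoot-kind p e a))
      (All.++⁺ (above (rightRoot-kind p e a)) (All.map (≤-trans (s≤s z≤n)) both>2)))
  where
  above : ∀ {m k} {xs : List (Forest (suc p))} {m<k : True (m <? k)} →
          All (λ ts → rootKind ts ≡ k) xs → All (λ ts → m < rootKind ts) xs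
  above {m<k = m<k} = All.map (λ eq → subst (_ <_) (sym eq) (toWitness m<k))
  both>2 : All (λ ts → 2 < rootKind ts) (bothRoot zero p e a ++ bothRoot (suc zero) p e a)
  both>2 = All.++⁺ (above (bothRoot-kind zero p e a)) (above (bothRoot-kind (suc zero) p e a))

leftRoot-unique p zero    a = []
leftRoot-unique p (suc e) a =
  Unique.map⁺ (λ { {_ ∷ _} {_ ∷ _} refl → refl }) (forests-unique (suc p) e a)

rightRoot-unique p e zero    = []
rightRoot-unique p e (suc a) =
  Unique.map⁺ (λ { {_ ∷ _} {_ ∷ _} refl → refl }) (forests-unique (suc p) e a)

bothRoot-unique b p zero    a       = []
bothRoot-unique b p (suc e) zero    = []
bothRoot-unique b p (suc e) (suc a) =
  Unique.map⁺ (λ { {_ ∷ _ ∷ _} {_ ∷ _ ∷ _} refl → refl }) (forests-unique (suc (suc p)) e a)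

-- Both lists are free of repetitions and have the same members once a tree is viewed as a one-tree
-- forest, so they are permutations of each other. Fixing vertices and right edges fixes the left
-- edges, by `vertices-edges`.
BoNa-forests : ∀ e a → BoNa (suc (e + a)) (suc a) ≡ length (forests 1 e a)
BoNa-forests e a = trans (sym (length-map (_∷ []) (countedTrees n k)))
  (↭-length (∼bag⇒↭ (unique∧set⇒bag (Unique.map⁺ (λ { refl → refl }) (countedTrees-unique n k))
    (forests-unique 1 e a) (mk⇔ to from))))
  where
  n = suc (e + a)
  k = suc a

  to : ∀ {ts} → ts ∈ map (_∷ []) (countedTrees n k) → ts ∈ forests 1 e a
  to i with t , j , refl ← ∈-map⁻ (_∷ []) i
       with v , r ← Equivalence.to (∈-countedTrees n k t) j =
    subst₂ (λ x y → t ∷ [] ∈ forests 1 x y) (trans (+-identityʳ _) left) (trans (+-identityʳ _) right)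
      (∷-∈-forests t (here refl))
    where
    right : rightEdges t ≡ a
    right = suc-injective r
    left : leftEdges t ≡ e
    left = +-cancelʳ-≡ a _ _ (trans (cong (leftEdges t +_) (sym right))
      (suc-injective (trans (sym (vertices-edges t)) v)))

  from : ∀ {ts} → ts ∈ forests 1 e a → ts ∈ map (_∷ []) (countedTrees n k)
  from {t ∷ []} i with l , r ← All.lookup (forests-edges 1 e a) i =
    ∈-map⁺ (_∷ []) (Equivalence.from (∈-countedTrees n k t)
      ( trans (vertices-edges t) (cong suc (cong₂ _+_ left right))
      , cong suc right))
    where
    left : leftEdges t ≡ e
    left = trans (sym (+-identityʳ _)) l
    right : rightEdges t ≡ a
    right = trans (sym (+-identityʳ _)) r

-- Coefficient sequences of power series in u.

Sequence : Set
Sequence = ℕ → ℕ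

δ : Sequence
δ zero    = 1
δ (suc _) = 0

shift : Sequence → Sequence
shift s zero    = 0
shift s (suc i) = s i

-- As an operation on power series, multiplication by 1 + ku; `shift` is multiplication by u.
timesLinear : ℕ → Sequence → Sequence
timesLinear k s i = s i + k * shift s i

derivative : Sequence → Sequence
derivative s i = suc i * s (suc i)

partialSum : Sequence → Sequence
partialSum s zero    = s 0
partialSum s (suc i) = partialSum s i + s (suc i)

shift-cong : ∀ {s t} → (∀ i → s i ≡ t i) → ∀ i → shift s i ≡ shift t i
shift-cong eq zero    = refl
shift-cong eq (suc i) = eq i

timesLinear-cong : ∀ k {s t} → (∀ i → s i ≡ t i) → ∀ i → timesLinear k s i ≡ timesLinear k t i
timesLinear-cong k eq i = cong₂ (λ x y → x + k * y) (eq i) (shift-cong eq i)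

shift-linear : ∀ m n s t i → shift (λ j → m * s j + n * t j) i ≡ m * shift s i + n * shift t i
shift-linear m n s t zero    = sym (cong₂ _+_ (*-zeroʳ m) (*-zeroʳ n))
shift-linear m n s t (suc i) = refl

timesLinear-linear : ∀ k m n s t i →
  timesLinear k (λ j → m * s j + n * t j) i ≡ m * timesLinear k s i + n * timesLinear k t i
timesLinear-linear k m n s t i = trans
  (cong (λ x → m * s i + n * t i + k * x) (shift-linear m n s t i))
  (rearrange k m n (s i) (t i) (shift s i) (shift t i))
  where
  rearrange : ∀ k m n x y u v →
    m * x + n * y + k * (m * u + n * v) ≡ m * (x + k * u) + n * (y + k * v)
  rearrange = solve-∀

timesLinear-comm : ∀ k l s i → timesLinear k (timesLinear l s) i ≡ timesLinear l (timesLinear k s) i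
timesLinear-comm k l s zero = rearrange k l (s 0)
  where
  rearrange : ∀ k l x → x + l * 0 + k * 0 ≡ x + k * 0 + l * 0
  rearrange = solve-∀
timesLinear-comm k l s (suc i) = rearrange k l (s (suc i)) (s i) (shift s i)
  where
  rearrange : ∀ k l x y z → x + l * y + k * (y + l * z) ≡ x + k * y + l * (y + k * z)
  rearrange = solve-∀

-- The product rule for (1 + ku)s.
derivative-timesLinear : ∀ k s i →
  derivative (timesLinear k s) i ≡ k * s i + timesLinear k (derivative s) i
derivative-timesLinear k s zero = rearrange k (s 0) (s 1)
  where
  rearrange : ∀ k x y → 1 * (y + k * x) ≡ k * x + (1 * y + k * 0)
  rearrange = solve-∀
derivative-timesLinear k s (suc i) = rearrange k i (s (suc i)) (s (suc (suc i)))
  where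
  rearrange : ∀ k i x y → suc (suc i) * (y + k * x) ≡ k * x + (suc (suc i) * y + k * (suc i * x))
  rearrange = solve-∀

-- The coefficients of (1 + 2u)^a (1 + u)^b.
linearPowers : ℕ → ℕ → Sequence
linearPowers zero    zero    = δ
linearPowers zero    (suc b) = timesLinear 1 (linearPowers zero b)
linearPowers (suc a) b       = timesLinear 2 (linearPowers a b)

binomial : ℕ → Sequence
binomial = linearPowers 0

-- `linearPowers` peels off the factors 1 + 2u first, so a factor 1 + u has to be commuted past all
-- of them.
linearPowers-suc : ∀ a b i → linearPowers a (suc b) i ≡ timesLinear 1 (linearPowers a b) i
linearPowers-suc zero    b i = refl
linearPowers-suc (suc a) b i = trans
  (timesLinear-cong 2 (linearPowers-suc a b) i)
  (timesLinear-comm 2 1 (linearPowers a b) i)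

-- The product rule for (1 + 2u)^a (1 + u)^b. The value of `pred` at 0 is harmless, since its term
-- then has coefficient 0.
linearPowers-derivative : ∀ a b i →
  derivative (linearPowers a b) i ≡ 2 * a * linearPowers (pred a) b i + b * linearPowers a (pred b) i
linearPowers-derivative zero zero i = *-zeroʳ (suc i)
linearPowers-derivative zero (suc b) i = begin
  derivative (timesLinear 1 (binomial b)) i
    ≡⟨ derivative-timesLinear 1 (binomial b) i ⟩
  1 * binomial b i + timesLinear 1 (derivative (binomial b)) i
    ≡⟨ cong (1 * binomial b i +_) (timesLinear-cong 1 (linearPowers-derivative zero b) i) ⟩
  1 * binomial b i + timesLinear 1 (λ j → b * binomial (pred b) j) i
    -- The coefficient 0 on the dummy summand `δ` reduces two-term linearity to a single term.
    ≡⟨ cong (1 * binomial b i +_) (timesLinear-linear 1 0 b δ (binomial (pred b)) i) ⟩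
  1 * binomial b i + b * timesLinear 1 (binomial (pred b)) i
    ≡⟨ cong (1 * binomial b i +_) (unpred b) ⟩
  1 * binomial b i + b * binomial b i
    ≡⟨ *-distribʳ-+ (binomial b i) 1 b ⟨
  suc b * binomial b i ∎
  where
  open ≡-Reasoning
  unpred : ∀ b → b * timesLinear 1 (binomial (pred b)) i ≡ b * binomial b i
  unpred zero    = refl
  unpred (suc b) = refl
linearPowers-derivative (suc a) b i = begin
  derivative (timesLinear 2 s) i
    ≡⟨ derivative-timesLinear 2 s i ⟩
  2 * s i + timesLinear 2 (derivative s) i
    ≡⟨ cong (2 * s i +_) (timesLinear-cong 2 (linearPowers-derivative a b) i) ⟩
  2 * s i + timesLinear 2 (λ j → 2 * a * linearPowers (pred a) b j + b * linearPowers a (pred b) j) i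
    ≡⟨ cong (2 * s i +_)
         (timesLinear-linear 2 (2 * a) b (linearPowers (pred a) b) (linearPowers a (pred b)) i) ⟩
  2 * s i + (2 * a * timesLinear 2 (linearPowers (pred a) b) i + b * linearPowers (suc a) (pred b) i)
    ≡⟨ cong (λ x → 2 * s i + (x + b * linearPowers (suc a) (pred b) i)) (unpred a) ⟩
  2 * s i + (2 * a * s i + b * linearPowers (suc a) (pred b) i)
    ≡⟨ rearrange a (s i) (b * linearPowers (suc a) (pred b) i) ⟩
  2 * suc a * s i + b * linearPowers (suc a) (pred b) i ∎
  where
  open ≡-Reasoning
  s = linearPowers a b
  unpred : ∀ a → 2 * a * timesLinear 2 (linearPowers (pred a) b) i ≡ 2 * a * linearPowers a b i
  unpred zero    = refl
  unpred (suc a) = refl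
  rearrange : ∀ a x y → 2 * x + (2 * a * x + y) ≡ 2 * suc a * x + y
  rearrange = solve-∀

-- Closed form for the forest counts.

count : ℕ → ℕ → ℕ → ℕ
count p e a = length (forests p e a)

-- The four terms correspond to the kind of the first root: leaf, left child only, right child only,
-- both. `shift` gives 0 where the edge to be deleted does not exist, and the factor 2 counts the
-- labels.
count-rec : ∀ p e a → count (suc p) e a ≡
  count p e a + shift (λ e → count (suc p) e a) e + shift (count (suc p) e) a
    + 2 * shift (λ e → shift (count (suc (suc p)) e) a) e
count-rec p e a = begin
  length (map (leaf ∷_) (forests p e a) ++ leftRoot p e a ++ rightRoot p e a
    ++ bothRoot zero p e a ++ bothRoot (suc zero) p e a)
    ≡⟨ length-++ (map (leaf ∷_) (forests p e a)) ⟩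
  _ ≡⟨ cong₂ _+_ (length-map (leaf ∷_) (forests p e a)) (length-++ (leftRoot p e a)) ⟩
  _ ≡⟨ cong (count p e a +_) (cong₂ _+_ (leftRoot-length e) (length-++ (rightRoot p e a))) ⟩
  _ ≡⟨ cong (λ x → count p e a + (shift (λ e → count (suc p) e a) e + x))
         (cong₂ _+_ (rightRoot-length a) (trans (length-++ (bothRoot zero p e a))
           (cong₂ _+_ (bothRoot-length zero e a) (bothRoot-length (suc zero) e a)))) ⟩
  _ ≡⟨ rearrange (count p e a) _ _ (shift (λ e → shift (count (suc (suc p)) e) a) e) ⟩
  count p e a + shift (λ e → count (suc p) e a) e + shift (count (suc p) e) a
    + 2 * shift (λ e → shift (count (suc (suc p)) e) a) e ∎
  where
  open ≡-Reasoning
  rearrange : ∀ w x y z → w + (x + (y + (z + z))) ≡ w + x + y + 2 * z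
  rearrange = solve-∀
  leftRoot-length : ∀ e → length (leftRoot p e a) ≡ shift (λ e → count (suc p) e a) e
  leftRoot-length zero    = refl
  leftRoot-length (suc e) = length-map graftLeft (forests (suc p) e a)
  rightRoot-length : ∀ a → length (rightRoot p e a) ≡ shift (count (suc p) e) a
  rightRoot-length zero    = refl
  rightRoot-length (suc a) = length-map graftRight (forests (suc p) e a)
  bothRoot-length : ∀ b e a →
    length (bothRoot b p e a) ≡ shift (λ e → shift (count (suc (suc p)) e) a) e
  bothRoot-length b zero    a       = refl
  bothRoot-length b (suc e) zero    = refl
  bothRoot-length b (suc e) (suc a) = length-map (graftBoth b) (forests (suc (suc p)) e a)

binomial-absorb : ∀ n a → a * binomial (suc n) a ≡ suc n * shift (binomial n) a
binomial-absorb n zero    = sym (*-zeroʳ (suc n))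
binomial-absorb n (suc a) = linearPowers-derivative 0 (suc n) a

-- Adding a C(n+1,a) to both sides avoids subtraction: absorption followed by Pascal's rule turns
-- the left side into (n+1) C(n+1,a), and n + 1 = (b + 1) + a.
binomial-complement : ∀ b a → let n = b + a in
  suc n * binomial n a ≡ suc b * binomial (suc n) a
binomial-complement b a = +-cancelʳ-≡ (a * binomial (suc n) a) _ _ (begin
  suc n * binomial n a + a * binomial (suc n) a
    ≡⟨ cong (suc n * binomial n a +_) (binomial-absorb n a) ⟩
  suc n * binomial n a + suc n * shift (binomial n) a
    ≡⟨ rearrange₁ n (binomial n a) (shift (binomial n) a) ⟩
  suc n * binomial (suc n) a
    ≡⟨ rearrange₂ b a (binomial (suc n) a) ⟩
  suc b * binomial (suc n) a + a * binomial (suc n) a ∎)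
  where
  open ≡-Reasoning
  n = b + a
  rearrange₁ : ∀ n x y → suc n * x + suc n * y ≡ suc n * (x + 1 * y)
  rearrange₁ = solve-∀
  rearrange₂ : ∀ b a x → suc (b + a) * x ≡ suc b * x + a * x
  rearrange₂ = solve-∀

-- Let F = (1 + 2u)^a (1 + u)^(b+1). Expand (b + 1) [u^e] F in two ways: by splitting a factor 1 + u
-- off F, and as (p + 1) [u^e] F + e [u^e] F with the last term read off F'. A common term cancels.
linearPowers-lower : ∀ a p e → let b = p + e in
  suc b * linearPowers a b e ≡
    suc p * linearPowers a (suc b) e + 2 * a * shift (linearPowers (pred a) (suc b)) e
linearPowers-lower a p e = +-cancelʳ-≡ (suc b * shift (linearPowers a b) e) _ _ (begin
  suc b * linearPowers a b e + suc b * shift (linearPowers a b) e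
    ≡⟨ rearrange₁ b (linearPowers a b e) (shift (linearPowers a b) e) ⟩
  suc b * timesLinear 1 (linearPowers a b) e
    ≡⟨ cong (suc b *_) (linearPowers-suc a b e) ⟨
  suc b * linearPowers a (suc b) e
    ≡⟨ *-distribʳ-+ (linearPowers a (suc b) e) (suc p) e ⟩
  suc p * linearPowers a (suc b) e + e * linearPowers a (suc b) e
    ≡⟨ cong (suc p * linearPowers a (suc b) e +_) (absorb e) ⟩
  suc p * linearPowers a (suc b) e +
    (2 * a * shift (linearPowers (pred a) (suc b)) e + suc b * shift (linearPowers a b) e)
    ≡⟨ +-assoc (suc p * linearPowers a (suc b) e) _ _ ⟨
  suc p * linearPowers a (suc b) e +
    2 * a * shift (linearPowers (pred a) (suc b)) e + suc b * shift (linearPowers a b) e ∎)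
  where
  open ≡-Reasoning
  b = p + e
  rearrange₁ : ∀ b x y → suc b * x + suc b * y ≡ suc b * (x + 1 * y)
  rearrange₁ = solve-∀
  absorb : ∀ {b} e → e * linearPowers a (suc b) e ≡
    2 * a * shift (linearPowers (pred a) (suc b)) e + suc b * shift (linearPowers a b) e
  absorb {b} zero    = sym (cong₂ _+_ (*-zeroʳ (2 * a)) (*-zeroʳ (suc b)))
  absorb {b} (suc e) = linearPowers-derivative a (suc b) e

-- For n = b + a, the coefficient of u^(e+a) y^a in
-- (1 + (1+y)u + 2yu²)^n = ((1+u) + yu(1+2u))^n.
weight : (n b e : ℕ) → Sequence
weight n b e a = binomial n a * linearPowers a b e

-- For n = b + a this multiplies the n-th power by one more factor. The summands 1, u, yu and 2yu²
-- of that factor give the four terms, in the order of the root kinds in `count-rec`.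
weight-pascal : ∀ n b e a → weight (suc n) (suc b) e a ≡
  weight n b e a + binomial n a * shift (linearPowers a b) e + shift (weight n (suc b) e) a
    + 2 * shift (λ a → binomial n a * shift (linearPowers a (suc b)) e) a
weight-pascal n b e zero =
  rearrange (binomial n 0) (binomial b e) (shift (binomial b) e)
  where
  rearrange : ∀ c x y → (c + 1 * 0) * (x + 1 * y) ≡ c * x + c * y + 0 + 2 * 0
  rearrange = solve-∀
weight-pascal n b e (suc a) = begin
  (c + 1 * d) * linearPowers (suc a) (suc b) e
    ≡⟨ expand c d (linearPowers (suc a) (suc b) e) ⟩
  c * linearPowers (suc a) (suc b) e + d * (x + 2 * y)
    ≡⟨ cong (λ z → c * z + d * (x + 2 * y)) (linearPowers-suc (suc a) b e) ⟩
  c * (u + 1 * v) + d * (x + 2 * y)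
    ≡⟨ collect c d u v x y ⟩
  c * u + c * v + d * x + 2 * (d * y) ∎
  where
  open ≡-Reasoning
  c = binomial n (suc a)
  d = binomial n a
  u = linearPowers (suc a) b e
  v = shift (linearPowers (suc a) b) e
  x = linearPowers a (suc b) e
  y = shift (linearPowers a (suc b)) e
  expand : ∀ c d z → (c + 1 * d) * z ≡ c * z + d * z
  expand = solve-∀
  collect : ∀ c d u v x y →
    c * (u + 1 * v) + d * (x + 2 * y) ≡ c * u + c * v + d * x + 2 * (d * y)
  collect = solve-∀

-- With P = 1 + (1+y)u + 2yu² and m = e + a, the identity (n+1) [u^m] P^n (P - uP') = (n+1-m) [u^m]
-- P^(n+1), where P - uP' = 1 - 2yu² and n + 1 - m = p + 1. It is stated without subtraction and
-- proved for one power of y at a time.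
weight-lower : ∀ p e a → let b = p + e; n = b + a in
  suc n * weight n b e a ≡ suc p * weight (suc n) (suc b) e a
    + 2 * (suc n * shift (λ a → binomial n a * shift (linearPowers a (suc b)) e) a)
weight-lower p e a = begin
  suc n * (binomial n a * linearPowers a b e)
    ≡⟨ *-assoc (suc n) (binomial n a) (linearPowers a b e) ⟨
  suc n * binomial n a * linearPowers a b e
    ≡⟨ cong (_* linearPowers a b e) (binomial-complement b a) ⟩
  suc b * C * linearPowers a b e
    ≡⟨ swap (suc b) C (linearPowers a b e) ⟩
  C * (suc b * linearPowers a b e)
    ≡⟨ cong (C *_) (linearPowers-lower a p e) ⟩
  C * (suc p * linearPowers a (suc b) e + 2 * a * shift (linearPowers (pred a) (suc b)) e)
    ≡⟨ rearrange C p a _ _ ⟩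
  suc p * (C * linearPowers a (suc b) e) + 2 * (a * C * shift (linearPowers (pred a) (suc b)) e)
    ≡⟨ cong (λ x → suc p * (C * linearPowers a (suc b) e) + 2 * x) (absorb n a) ⟩
  suc p * (C * linearPowers a (suc b) e)
    + 2 * (suc n * shift (λ a → binomial n a * shift (linearPowers a (suc b)) e) a) ∎
  where
  open ≡-Reasoning
  b = p + e
  n = b + a
  C = binomial (suc n) a
  swap : ∀ x y z → x * y * z ≡ y * (x * z)
  swap = solve-∀
  rearrange : ∀ c p a x y → c * (suc p * x + 2 * a * y) ≡ suc p * (c * x) + 2 * (a * c * y)
  rearrange = solve-∀
  absorb : ∀ n a → a * binomial (suc n) a * shift (linearPowers (pred a) (suc b)) e ≡
    suc n * shift (λ a → binomial n a * shift (linearPowers a (suc b)) e) a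
  absorb n zero    = sym (*-zeroʳ (suc n))
  absorb n (suc a) = trans
    (cong (_* shift (linearPowers a (suc b)) e) (binomial-absorb n (suc a)))
    (*-assoc (suc n) (binomial n a) (shift (linearPowers a (suc b)) e))

-- After multiplying by N, the induction hypotheses give the four weights the multiplicities p, p+1,
-- p+1 and p+2. Adding (N+1) w₀ to both sides raises the first to p+1; the surplus in the last,
-- 2(N+1) w₃, is exactly what `lower` accounts for.
count-arithmetic : ∀ N p {f₀ f₁ f₂ f₃ w₀ w₁ w₂ w₃ W} .{{_ : NonZero N}} →
  N * f₀ ≡ p * w₀ → N * f₁ ≡ suc p * w₁ → N * f₂ ≡ suc p * w₂ → N * f₃ ≡ suc (suc p) * w₃ →
  W ≡ w₀ + w₁ + w₂ + 2 * w₃ → suc N * w₀ ≡ suc p * W + 2 * (suc N * w₃) →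
  suc N * (f₀ + f₁ + f₂ + 2 * f₃) ≡ suc p * W
count-arithmetic N p {f₀} {f₁} {f₂} {f₃} {w₀} {w₁} {w₂} {w₃} {W} eq₀ eq₁ eq₂ eq₃ pascal lower =
  *-cancelˡ-≡ _ _ N (+-cancelʳ-≡ (suc N * w₀) _ _ (begin
    N * (suc N * (f₀ + f₁ + f₂ + 2 * f₃)) + suc N * w₀
      ≡⟨ expand N f₀ f₁ f₂ f₃ w₀ ⟩
    suc N * (N * f₀ + N * f₁ + N * f₂ + 2 * (N * f₃) + w₀)
      ≡⟨ cong (λ x → suc N * (x + w₀))
           (cong₂ _+_ (cong₂ _+_ (cong₂ _+_ eq₀ eq₁) eq₂) (cong (2 *_) eq₃)) ⟩
    suc N * (p * w₀ + suc p * w₁ + suc p * w₂ + 2 * (suc (suc p) * w₃) + w₀)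
      ≡⟨ collect N p w₀ w₁ w₂ w₃ ⟩
    suc N * (suc p * (w₀ + w₁ + w₂ + 2 * w₃)) + 2 * (suc N * w₃)
      ≡⟨ cong (λ x → suc N * (suc p * x) + 2 * (suc N * w₃)) pascal ⟨
    suc N * (suc p * W) + 2 * (suc N * w₃)
      ≡⟨ split N (suc p * W) (2 * (suc N * w₃)) ⟩
    N * (suc p * W) + (suc p * W + 2 * (suc N * w₃))
      ≡⟨ cong (N * (suc p * W) +_) lower ⟨
    N * (suc p * W) + suc N * w₀ ∎))
  where
  open ≡-Reasoning
  expand : ∀ N f₀ f₁ f₂ f₃ w → N * (suc N * (f₀ + f₁ + f₂ + 2 * f₃)) + suc N * w
    ≡ suc N * (N * f₀ + N * f₁ + N * f₂ + 2 * (N * f₃) + w)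
  expand = solve-∀
  collect : ∀ N p w₀ w₁ w₂ w₃ →
    suc N * (p * w₀ + suc p * w₁ + suc p * w₂ + 2 * (suc (suc p) * w₃) + w₀)
    ≡ suc N * (suc p * (w₀ + w₁ + w₂ + 2 * w₃)) + 2 * (suc N * w₃)
  collect = solve-∀
  split : ∀ N x y → suc N * x + y ≡ N * x + (x + y)
  split = solve-∀

CountFormula : ℕ → Set
CountFormula n = ∀ p e a → n ≡ p + e + a → n * count p e a ≡ p * weight n (p + e) e a

-- Every term of `count-rec` counts forests on N vertices, with p, p+1, p+1 and p+2 trees
-- respectively. Hence the induction runs over the number of vertices and must be uniform in the
-- number of trees.
count-step : ∀ N .{{_ : NonZero N}} → CountFormula N → ∀ p e a → N ≡ p + e + a →
             suc N * count (suc p) e a ≡ suc p * weight (suc N) (suc (p + e)) e a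
count-step N ih p e a eq = trans (cong (suc N *_) (count-rec p e a))
  (count-arithmetic N p {w₃ = shift (λ a → binomial N a * shift (linearPowers a (suc (p + e))) e) a}
    (ih p e a eq) (left e eq) (right a eq) (branch e a eq)
    (weight-pascal N (p + e) e a)
    (subst (λ n → suc n * weight n (p + e) e a ≡ suc p * weight (suc n) (suc (p + e)) e a
        + 2 * (suc n * shift (λ a → binomial n a * shift (linearPowers a (suc (p + e))) e) a))
      (sym eq) (weight-lower p e a)))
  where
  both-zero : ∀ k → N * 0 ≡ k * 0
  both-zero k = trans (*-zeroʳ N) (sym (*-zeroʳ k))

  left : ∀ e → N ≡ p + e + a → N * shift (λ e → count (suc p) e a) e ≡
    suc p * (binomial N a * shift (linearPowers a (p + e)) e)
  left zero    _  = trans (both-zero (suc p)) (cong (suc p *_) (sym (*-zeroʳ (binomial N a))))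
  left (suc e) eq = subst (λ b → N * count (suc p) e a ≡ suc p * weight N b e a)
    (sym (+-suc p e)) (ih (suc p) e a (trans eq (cong (_+ a) (+-suc p e))))

  right : ∀ a → N ≡ p + e + a → N * shift (count (suc p) e) a ≡
    suc p * shift (weight N (suc (p + e)) e) a
  right zero    _  = both-zero (suc p)
  right (suc a) eq = ih (suc p) e a (trans eq (+-suc (p + e) a))

  branch : ∀ e a → N ≡ p + e + a → N * shift (λ e → shift (count (suc (suc p)) e) a) e ≡
    suc (suc p) * shift (λ a → binomial N a * shift (linearPowers a (suc (p + e))) e) a
  branch zero    zero    _  = both-zero (suc (suc p))
  branch zero    (suc a) _  = trans (both-zero (suc (suc p)))
    (cong (suc (suc p) *_) (sym (*-zeroʳ (binomial N a))))
  branch (suc e) zero    _  = both-zero (suc (suc p))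
  branch (suc e) (suc a) eq = subst (λ b → N * count (suc (suc p)) e a ≡ suc (suc p) * weight N b e a)
    (cong suc (sym (+-suc p e)))
    (ih (suc (suc p)) e a
      (trans eq (trans (+-suc (p + suc e) a) (cong (λ x → suc (x + a)) (+-suc p e)))))

count-formula : ∀ n → CountFormula n
count-formula zero          zero    e       a       eq = refl
count-formula (suc n)       zero    zero    (suc a) eq = *-zeroʳ n
count-formula (suc n)       zero    (suc e) a       eq = *-zeroʳ n
-- A single vertex is checked directly, because `count-step` would have to cancel N = 0 here.
count-formula (suc zero)    (suc p) e       a       eq
  with refl ← m+n≡0⇒m≡0 p (m+n≡0⇒m≡0 (p + e) (sym (suc-injective eq)))
  with refl ← m+n≡0⇒m≡0 e (sym (suc-injective eq))
  with refl ← suc-injective eq = refl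
count-formula (suc (suc n)) (suc p) e       a       eq =
  count-step (suc n) (count-formula (suc n)) p e a (suc-injective eq)

-- Strong log-concavity and its closure properties.

-- Nonnegativity of the 2×2 minors of the Toeplitz matrix of `s`, that is, log-concavity without
-- internal zeros. This form needs no division, so sequences with zeros such as `δ` and the binomial
-- rows are covered.
StronglyLogConcave : Sequence → Set
StronglyLogConcave s = ∀ {a b c d} → a ≤ c → a ≤ d → a + b ≡ c + d → s a * s b ≤ s c * s d

δ-slc : StronglyLogConcave δ
δ-slc {zero}  {zero}  {zero} {zero} _ _ _ = ≤-refl
δ-slc {zero}  {suc _} _ _ _ = z≤n
δ-slc {suc _} _ _ _ = z≤n

outer-equal : ∀ (s : Sequence) a {b d} → a + b ≡ a + d → s a * s b ≤ s a * s d
outer-equal s a eq = ≤-reflexive (cong (λ x → s a * s x) (+-cancelˡ-≡ a _ _ eq))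

-- Both products expand into four terms, compared one by one. As `a` is strictly below both inner
-- indices, the inner pair stays within the outer one when an index on each side drops by one.
timesLinear-slc-interior : ∀ k {s} → StronglyLogConcave s → ∀ {a b c d} →
  a ≤ c → a ≤ d → a + suc b ≡ suc c + suc d →
  timesLinear k s a * timesLinear k s (suc b) ≤ timesLinear k s (suc c) * timesLinear k s (suc d)
timesLinear-slc-interior k {s} lc {a} {b} {c} {d} a≤c a≤d eq = begin
  timesLinear k s a * timesLinear k s (suc b)
    ≡⟨ expand k (s a) (shift s a) (s (suc b)) (s b) ⟩
  s a * s (suc b) + k * (s a * s b) + k * (shift s a * s (suc b)) + k * k * (shift s a * s b)
    ≤⟨ +-mono-≤ (+-mono-≤ (+-mono-≤
         (lc (m≤n⇒m≤1+n a≤c) (m≤n⇒m≤1+n a≤d) eq)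
         (*-monoʳ-≤ k (lc (m≤n⇒m≤1+n a≤c) a≤d eq₁)))
         (*-monoʳ-≤ k (shifted a≤c (m≤n⇒m≤1+n a≤d) eq)))
         (*-monoʳ-≤ (k * k) (shifted a≤c a≤d eq₁)) ⟩
  s (suc c) * s (suc d) + k * (s (suc c) * s d) + k * (s c * s (suc d)) + k * k * (s c * s d)
    ≡⟨ expand k (s (suc c)) (s c) (s (suc d)) (s d) ⟨
  timesLinear k s (suc c) * timesLinear k s (suc d) ∎
  where
  open ≤-Reasoning
  expand : ∀ k x x′ y y′ → (x + k * x′) * (y + k * y′) ≡
    x * y + k * (x * y′) + k * (x′ * y) + k * k * (x′ * y′)
  expand = solve-∀
  eq₁ : a + b ≡ suc c + d
  eq₁ = suc-injective (trans (sym (+-suc a b)) (trans eq (+-suc (suc c) d)))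
  shifted : ∀ {a b c d} → a ≤ c → a ≤ d → a + b ≡ suc c + d → shift s a * s b ≤ s c * s d
  shifted {zero}  _   _   _  = z≤n
  shifted {suc a} a<c a<d eq = lc (<⇒≤ a<c) (<⇒≤ a<d) (suc-injective eq)

timesLinear-slc : ∀ k {s} → StronglyLogConcave s → StronglyLogConcave (timesLinear k s)
timesLinear-slc k {s} lc {a} {b} {c} {d} a≤c a≤d eq with m≤n⇒m<n∨m≡n a≤c | m≤n⇒m<n∨m≡n a≤d
... | inj₂ refl | _         = outer-equal (timesLinear k s) a eq
... | _         | inj₂ refl = ≤-trans (outer-equal (timesLinear k s) a (trans eq (+-comm c a)))
                                (≤-reflexive (*-comm (timesLinear k s a) (timesLinear k s c)))
-- Inner indices strictly above `a` force the outer index `b` to be positive.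
timesLinear-slc k {s} lc {a} {zero} {suc c} {suc d} a≤c a≤d eq | inj₁ (s≤s a<c) | inj₁ (s≤s a<d) =
  contradiction (trans (sym (+-identityʳ a)) eq) (<⇒≢ (s≤s (≤-trans a<c (m≤m+n c (suc d)))))
timesLinear-slc k {s} lc {a} {suc b} {suc c} {suc d} a≤c a≤d eq | inj₁ (s≤s a<c) | inj₁ (s≤s a<d) =
  timesLinear-slc-interior k {s} lc a<c a<d eq

≤-partialSum : ∀ s i → s i ≤ partialSum s i
≤-partialSum s zero    = ≤-refl
≤-partialSum s (suc i) = m≤n+m _ _

-- Compare the sums from the top: s(a-i) s(b) ≤ s(c-i) s(d) for every i ≤ a, and the remaining c - a
-- terms on the right are nonnegative.
slc-partialSum : ∀ {s} → StronglyLogConcave s → ∀ {a b c d} → a ≤ c → a ≤ d → a + b ≡ c + d →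
                 partialSum s a * s b ≤ partialSum s c * s d
slc-partialSum {s} lc {zero} {b} {c} {d} a≤c a≤d eq =
  ≤-trans (lc a≤c a≤d eq) (*-monoˡ-≤ (s d) (≤-partialSum s c))
slc-partialSum {s} lc {suc a} {b} {suc c} {d} (s≤s a≤c) a<d eq = begin
  (partialSum s a + s (suc a)) * s b
    ≡⟨ *-distribʳ-+ (s b) (partialSum s a) (s (suc a)) ⟩
  partialSum s a * s b + s (suc a) * s b
    ≤⟨ +-mono-≤ (slc-partialSum lc a≤c (<⇒≤ a<d) (suc-injective eq)) (lc (s≤s a≤c) a<d eq) ⟩
  partialSum s c * s d + s (suc c) * s d
    ≡⟨ *-distribʳ-+ (s d) (partialSum s c) (s (suc c)) ⟨
  (partialSum s c + s (suc c)) * s d ∎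
  where open ≤-Reasoning

slc-cong : ∀ {s t} → (∀ i → s i ≡ t i) → StronglyLogConcave t → StronglyLogConcave s
slc-cong {s} {t} eq lc {a} {b} {c} {d} p q r =
  subst₂ _≤_ (sym (cong₂ _*_ (eq a) (eq b))) (sym (cong₂ _*_ (eq c) (eq d))) (lc p q r)

-- Any inner pair is reached from the outer one by steps that move both indices inwards by 1. As the
-- hypothesis covers all i ≤ j and not only consecutive triples, the steps chain without division.
slc-adjacent : ∀ (s : Sequence) → (∀ {i j} → i ≤ j → s i * s (suc j) ≤ s (suc i) * s j) →
               StronglyLogConcave s
slc-adjacent s adjacent {a} {b} {c} {d} a≤c a≤d eq =
  [ (λ c≤d → nested a≤c c≤d eq)
  , (λ d≤c → subst (s a * s b ≤_) (*-comm (s d) (s c)) (nested a≤d d≤c (trans eq (+-comm c d))))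
  ]′ (≤-total c d)
  where
  inwards : ∀ m {a d} → a + m ≤ d → s a * s (m + d) ≤ s (a + m) * s d
  inwards zero    {a} {d} _ = ≤-reflexive (cong (λ x → s x * s d) (sym (+-identityʳ a)))
  inwards (suc m) {a} {d} le = begin
    s a * s (suc (m + d))   ≤⟨ adjacent (≤-trans (m≤m+n a (suc m)) (≤-trans le (m≤n+m d m))) ⟩
    s (suc a) * s (m + d)   ≤⟨ inwards m (subst (_≤ d) (+-suc a m) le) ⟩
    s (suc a + m) * s d     ≡⟨ cong (λ x → s x * s d) (+-suc a m) ⟨
    s (a + suc m) * s d     ∎
    where open ≤-Reasoning
  nested : ∀ {a b c d} → a ≤ c → c ≤ d → a + b ≡ c + d → s a * s b ≤ s c * s d
  nested {a} {b} {_} {d} a≤c c≤d eq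
    with m , refl ← m≤n⇒∃[o]m+o≡n a≤c
    with refl ← +-cancelˡ-≡ a b (m + d) (trans eq (+-assoc a m d)) = inwards m c≤d

+-suc-swap : ∀ i j → i + suc j ≡ j + suc i
+-suc-swap i j = trans (+-comm i (suc j)) (sym (+-suc j i))

-- For adjacent moves the product of the partial sums at i and j is common to both sides, and what
-- is left is an instance of `slc-partialSum`.
partialSum-slc : ∀ {s} → StronglyLogConcave s → StronglyLogConcave (partialSum s)
partialSum-slc {s} lc = slc-adjacent (partialSum s) λ {i} {j} i≤j → begin
  partialSum s i * (partialSum s j + s (suc j))
    ≡⟨ *-distribˡ-+ (partialSum s i) (partialSum s j) (s (suc j)) ⟩
  partialSum s i * partialSum s j + partialSum s i * s (suc j)
    ≤⟨ +-monoʳ-≤ (partialSum s i * partialSum s j)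
         (slc-partialSum lc {i} {suc j} {j} {suc i} i≤j (n≤1+n i) (+-suc-swap i j)) ⟩
  partialSum s i * partialSum s j + partialSum s j * s (suc i)
    ≡⟨ rearrange (partialSum s i) (partialSum s j) (s (suc i)) ⟩
  (partialSum s i + s (suc i)) * partialSum s j ∎
  where
  open ≤-Reasoning
  rearrange : ∀ x y z → x * y + y * z ≡ (x + z) * y
  rearrange = solve-∀

*-partialSum-mono : ∀ x y {s t} c → (∀ {i} → i ≤ c → x * s i ≤ y * t i) →
                    x * partialSum s c ≤ y * partialSum t c
*-partialSum-mono x y         zero    le = le z≤n
*-partialSum-mono x y {s} {t} (suc c) le = begin
  x * (partialSum s c + s (suc c))     ≡⟨ *-distribˡ-+ x _ _ ⟩
  x * partialSum s c + x * s (suc c)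
    ≤⟨ +-mono-≤ (*-partialSum-mono x y c (λ i≤c → le (m≤n⇒m≤1+n i≤c))) (le ≤-refl) ⟩
  y * partialSum t c + y * t (suc c)   ≡⟨ *-distribˡ-+ y _ _ ⟨
  y * (partialSum t c + t (suc c))     ∎
  where open ≤-Reasoning

-- The array R(a,c): rows, columns and antidiagonals.

row : ℕ → Sequence
row a c = linearPowers a (suc c) c

row-zero : ∀ c → row 0 c ≡ suc c
row-zero zero    = refl
row-zero (suc c) = *-cancelˡ-≡ _ _ (suc c) (trans (linearPowers-derivative 0 (suc (suc c)) c)
  (trans (cong (suc (suc c) *_) (row-zero c)) (*-comm (suc (suc c)) (suc c))))

row-at-0 : ∀ a → row (suc a) 0 ≡ row a 0
row-at-0 a = +-identityʳ _

-- Split off 1 + 2u, then 1 + u from the doubled term, and regroup. Together with `row-zero` and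
-- `row-at-0` this gives row a the generating function (1+v)^a / (1-v)^(a+2).
row-suc : ∀ a c → row (suc a) (suc c) ≡ row (suc a) c + (row a (suc c) + row a c)
row-suc a c = trans
  (cong (λ x → row a (suc c) + 2 * x) (linearPowers-suc a (suc c) c))
  (rearrange (row a (suc c)) (row a c) (shift (linearPowers a (suc c)) c))
  where
  rearrange : ∀ x y z → x + 2 * (y + 1 * z) ≡ y + 2 * z + (x + y)
  rearrange = solve-∀

-- The factor (1+v)/(1-v) as two operations that each preserve strong log-concavity; used for
-- `row-slc`.
row-partialSum-timesLinear : ∀ a c → row (suc a) c ≡ partialSum (timesLinear 1 (row a)) c
row-partialSum-timesLinear a zero    = refl
row-partialSum-timesLinear a (suc c) = trans (row-suc a c)
  (cong₂ (λ x y → x + (row a (suc c) + y))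
    (row-partialSum-timesLinear a c) (sym (+-identityʳ (row a c))))

-- The same factor as 1 + 2v/(1-v), which isolates a copy of row a that cancels in the minors and in
-- the column inequality.
row-partialSum : ∀ a c → row (suc a) (suc c) ≡ row a (suc c) + 2 * partialSum (row a) c
row-partialSum a zero    = trans (row-suc a 0)
  (trans (cong (_+ (row a 1 + row a 0)) (row-at-0 a)) (rearrange (row a 0) (row a 1)))
  where
  rearrange : ∀ x y → x + (y + x) ≡ y + 2 * x
  rearrange = solve-∀
row-partialSum a (suc c) = trans (row-suc a (suc c))
  (trans (cong (_+ (row a (suc (suc c)) + row a (suc c))) (row-partialSum a c))
    (rearrange (row a (suc c)) (partialSum (row a) c) (row a (suc (suc c)))))
  where
  rearrange : ∀ x s y → x + 2 * s + (y + x) ≡ y + 2 * (s + x)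
  rearrange = solve-∀

binomial-slc : ∀ n → StronglyLogConcave (binomial n)
binomial-slc zero    = δ-slc
binomial-slc (suc n) = timesLinear-slc 1 {binomial n} (binomial-slc n)

row-slc : ∀ a → StronglyLogConcave (row a)
row-slc zero = slc-cong row-zero (slc-adjacent suc λ {i} {j} i≤j → begin
  suc i * suc (suc j)         ≡⟨ *-suc (suc i) (suc j) ⟩
  suc i + suc i * suc j       ≤⟨ +-monoˡ-≤ (suc i * suc j) (s≤s i≤j) ⟩
  suc (suc i) * suc j         ∎)
  where open ≤-Reasoning
row-slc (suc a) =
  slc-cong (row-partialSum-timesLinear a) 
    (partialSum-slc {timesLinear 1 (row a)} (timesLinear-slc 1 {row a} (row-slc a)))

row-mono : ∀ a c → row a c ≤ row (suc a) c
row-mono a c = m≤m+n _ _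

-- Expanding row a+1 by `row-partialSum` leaves a common product and an instance of
-- `slc-partialSum`. In column 0 the two rows agree, so there monotonicity in `a` suffices.
row-ratio : ∀ a {i j} → i ≤ j → row a j * row (suc a) i ≤ row a i * row (suc a) j
row-ratio a {zero} {j} _ = begin
  row a j * row (suc a) 0   ≡⟨ cong (row a j *_) (row-at-0 a) ⟩
  row a j * row a 0         ≤⟨ *-monoˡ-≤ (row a 0) (row-mono a j) ⟩
  row (suc a) j * row a 0   ≡⟨ *-comm (row (suc a) j) (row a 0) ⟩
  row a 0 * row (suc a) j   ∎
  where open ≤-Reasoning
row-ratio a {suc i} {suc j} (s≤s i≤j) = begin
  row a (suc j) * row (suc a) (suc i)
    ≡⟨ cong (row a (suc j) *_) (row-partialSum a i) ⟩
  row a (suc j) * (row a (suc i) + 2 * partialSum (row a) i)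
    ≡⟨ expand (row a (suc j)) (row a (suc i)) (partialSum (row a) i) ⟩
  row a (suc i) * row a (suc j) + 2 * (partialSum (row a) i * row a (suc j))
    ≤⟨ +-monoʳ-≤ (row a (suc i) * row a (suc j)) (*-monoʳ-≤ 2
         (slc-partialSum (row-slc a) {i} {suc j} {j} {suc i} i≤j (n≤1+n i) (+-suc-swap i j))) ⟩
  row a (suc i) * row a (suc j) + 2 * (partialSum (row a) j * row a (suc i))
    ≡⟨ collect (row a (suc i)) (row a (suc j)) (partialSum (row a) j) ⟩
  row a (suc i) * (row a (suc j) + 2 * partialSum (row a) j)
    ≡⟨ cong (row a (suc i) *_) (row-partialSum a j) ⟨
  row a (suc i) * row (suc a) (suc j) ∎
  where
  open ≤-Reasoning
  expand : ∀ x y z → x * (y + 2 * z) ≡ y * x + 2 * (z * x)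
  expand = solve-∀
  collect : ∀ x y z → x * y + 2 * (z * x) ≡ x * (y + 2 * z)
  collect = solve-∀

-- Expand one factor on each side by `row-partialSum`. The products x y cancel, and the rest is
-- `row-ratio` between columns i ≤ c and column c+1, summed over i.
column-log-concave : ∀ a c → row a c * row (2 + a) c ≤ row (1 + a) c * row (1 + a) c
column-log-concave a zero = ≤-reflexive
  (cong₂ _*_ (sym (row-at-0 a)) (row-at-0 (suc a)))
column-log-concave a (suc c) = begin
  x * row (2 + a) (suc c)
    ≡⟨ cong (x *_) (row-partialSum (suc a) c) ⟩
  x * (y + 2 * partialSum (row (suc a)) c)
    ≡⟨ expand x y (partialSum (row (suc a)) c) ⟩
  y * x + 2 * (x * partialSum (row (suc a)) c)
    ≤⟨ +-monoʳ-≤ (y * x) (*-monoʳ-≤ 2 (*-partialSum-mono x y c λ {i} i≤c →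
         subst (x * row (suc a) i ≤_) (*-comm (row a i) y) (row-ratio a (m≤n⇒m≤1+n i≤c)))) ⟩
  y * x + 2 * (y * partialSum (row a) c)
    ≡⟨ collect x y (partialSum (row a) c) ⟩
  y * (x + 2 * partialSum (row a) c)
    ≡⟨ cong (y *_) (row-partialSum a c) ⟨
  y * y ∎
  where
  open ≤-Reasoning
  x = row a (suc c)
  y = row (suc a) (suc c)
  expand : ∀ x y z → x * (y + 2 * z) ≡ y * x + 2 * (x * z)
  expand = solve-∀
  collect : ∀ x y z → y * x + 2 * (y * z) ≡ y * (x + 2 * z)
  collect = solve-∀

row-positive : ∀ a c → 0 < row a c
row-positive zero    c = subst (0 <_) (sym (row-zero c)) z<s
row-positive (suc a) c = ≤-trans (row-positive a c) (row-mono a c)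

-- In the 3×3 block centred at `m`, the two minors used both contain `m`, and the product of their
-- right sides regroups into the column and the row through `m`. Positivity of `m` permits
-- cancelling m².
antidiagonal-log-concave : ∀ a c →
  row a (2 + c) * row (2 + a) c ≤ row (1 + a) (1 + c) * row (1 + a) (1 + c)
antidiagonal-log-concave a c = *-cancelʳ-≤ _ _ (m * m) {{m*n≢0 m m}} (begin
  row a (2 + c) * row (2 + a) c * (m * m)
    ≡⟨ pair (row a (2 + c)) (row (2 + a) c) m ⟩
  (row a (2 + c) * m) * (m * row (2 + a) c)
    ≤⟨ *-mono-≤ (row-ratio a (n≤1+n (1 + c))) (row-ratio (1 + a) (n≤1+n c)) ⟩
  (row a (1 + c) * row (1 + a) (2 + c)) * (row (1 + a) c * row (2 + a) (1 + c))
    ≡⟨ regroup (row a (1 + c)) (row (1 + a) (2 + c)) (row (1 + a) c) (row (2 + a) (1 + c)) ⟩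
  (row a (1 + c) * row (2 + a) (1 + c)) * (row (1 + a) c * row (1 + a) (2 + c))
    ≤⟨ *-mono-≤ (column-log-concave a (1 + c))
         (row-slc (1 + a) {c} {2 + c} {1 + c} {1 + c} (n≤1+n c) (n≤1+n c) (+-suc c (1 + c))) ⟩
  (m * m) * (m * m) ∎)
  where
  open ≤-Reasoning
  m = row (1 + a) (1 + c)
  instance
    m≢0 : NonZero m
    m≢0 = >-nonZero (row-positive (1 + a) (1 + c))
  pair : ∀ x y m → x * y * (m * m) ≡ (x * m) * (m * y)
  pair = solve-∀
  regroup : ∀ x u v y → (x * u) * (v * y) ≡ (x * y) * (v * u)
  regroup = solve-∀

-- Log-concavity of the Boolean-Narayana numbers.

BoNa-formula : ∀ {n} e a → n ≡ suc (e + a) → n * BoNa n (suc a) ≡ binomial n a * row a e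
BoNa-formula e a refl = trans (cong (suc (e + a) *_) (BoNa-forests e a))
  (trans (count-formula (suc (e + a)) 1 e a refl) (*-identityˡ _))

-- At fixed n the trees with a, a+1 and a+2 right edges have e+2, e+1 and e left edges, so the three
-- entries of R lie on one antidiagonal. Scaling by n² makes `BoNa-formula` applicable to every
-- factor.
BoNa-log-concave : ∀ e a → let n = suc (2 + e + a) in
  BoNa n (1 + a) * BoNa n (3 + a) ≤ BoNa n (2 + a) * BoNa n (2 + a)
BoNa-log-concave e a = *-cancelˡ-≤ (n * n) (begin
  n * n * (BoNa n (1 + a) * BoNa n (3 + a))
    ≡⟨ interchange n n (BoNa n (1 + a)) (BoNa n (3 + a)) ⟩
  (n * BoNa n (1 + a)) * (n * BoNa n (3 + a))
    ≡⟨ cong₂ _*_ (BoNa-formula (2 + e) a refl)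
         (BoNa-formula e (2 + a)
           (cong suc (trans (cong suc (sym (+-suc e a))) (sym (+-suc e (suc a)))))) ⟩
  (binomial n a * row a (2 + e)) * (binomial n (2 + a) * row (2 + a) e)
    ≡⟨ interchange (binomial n a) (binomial n (2 + a)) (row a (2 + e)) (row (2 + a) e) ⟨
  binomial n a * binomial n (2 + a) * (row a (2 + e) * row (2 + a) e)
    ≤⟨ *-mono-≤ (binomial-slc n {a} {2 + a} {1 + a} {1 + a} (n≤1+n a) (n≤1+n a) (+-suc a (1 + a)))
         (antidiagonal-log-concave a e) ⟩
  binomial n (1 + a) * binomial n (1 + a) * (row (1 + a) (1 + e) * row (1 + a) (1 + e))
    ≡⟨ interchange (binomial n (1 + a)) (binomial n (1 + a)) (row (1 + a) (1 + e)) (row (1 + a) (1 + e)) ⟩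
  (binomial n (1 + a) * row (1 + a) (1 + e)) * (binomial n (1 + a) * row (1 + a) (1 + e))
    ≡⟨ cong₂ _*_ middle middle ⟨
  (n * BoNa n (2 + a)) * (n * BoNa n (2 + a))
    ≡⟨ interchange n n (BoNa n (2 + a)) (BoNa n (2 + a)) ⟨
  n * n * (BoNa n (2 + a) * BoNa n (2 + a)) ∎)
  where
  open ≤-Reasoning
  n = suc (2 + e + a)
  middle : n * BoNa n (2 + a) ≡ binomial n (1 + a) * row (1 + a) (1 + e)
  middle = BoNa-formula (1 + e) (1 + a) (cong suc (cong suc (sym (+-suc e a))))
  interchange : ∀ w x y z → w * x * (y * z) ≡ (w * y) * (x * z)
  interchange = solve-∀

corollary5p2 : (n : ℕ) → .{{_ : NonZero n}} →
    LogConcave (λ (i : Fin n) → BoNa n (suc (toℕ i)))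
corollary5p2 n h i j i≡1+h j≡1+i
  with toℕ h | toℕ i | toℕ j | i≡1+h | j≡1+i | toℕ<n j
-- Here `j<n` says 3 + a ≤ n; the excess `e` is the number of left edges of the trees counted by the
-- last of the three terms.
... | a | _ | _ | refl | refl | j<n with m≤n⇒∃[o]m+o≡n j<n
...   | e , refl = subst
  (λ m → BoNa m (1 + a) * BoNa m (3 + a) ≤ BoNa m (2 + a) * BoNa m (2 + a))
  (cong (λ x → 3 + x) (+-comm e a)) (BoNa-log-concave e a)
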